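{- Let $p,q$ be positive integers with $p>2q$, and let $F$ be a triangle-free graph. Then the following are equivalent: (1) every clique blowup $G$ of $F$ satisfies $\chi(G)\leq\lceil\frac{p}{2q}\omega(G)\rceil$; (2) every clique blowup $G'$ of $F$ with $\omega(G')\leq\max\{\frac{2q(p-q-2)}{p-2q},\,2q\}$ satisfies $\chi(G')\leq\lceil\frac{p}{2q}\omega(G')\rceil$.
   Context: All graphs are finite and simple. $\chi(G)$ denotes the chromatic number and $\omega(G)$ the clique number (maximum size of a set of pairwise adjacent vertices) of $G$. Substituting a vertex $v$ of a graph $H$ by a graph $K$ produces the graph with vertex set $V(K)\cup V(H-v)$ and edge set $E(K)\cup E(H-v)\cup\{xy : x\in V(K),\ y\in N_H(v)\}$. A clique blowup of a graph $H$ is a graph obtained from $H$ by substituting every vertex of $H$ by a clique (a complete graph), where these cliques are allowed to be empty. -}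

module Defs where

import Algebra.Properties.Monoid.Sum
open import Data.Fin.Base using (Fin; zero; suc; finToFun; funToFin)
open import Data.Fin.Properties using (_≟_; all?; any?; +↔⊎; finToFun-funToFin)
open import Data.Fin.Subset using (Subset; _∈_; ∣_∣; ⊥)
open import Data.Fin.Subset.Properties using (_∈?_; ∣p∣≤n; anySubset?; ∉⊥; ∣⊥∣≡0)
open import Data.Integer.Base as ℤ using (+_)
open import Data.Nat.Base as ℕ using (ℕ; zero; suc; z≤n; s≤s)
import Data.Nat.Properties as ℕ
open import Data.Product.Base using (Σ; ∃; _×_; _,_; proj₁; proj₂)
open import Data.Rational.Base as ℚ using (ℚ; _/_)
open import Data.Sum.Base using (_⊎_; inj₁; inj₂; [_,_]′)
open import Data.Sum.Function.Propositional using (_⊎-↔_)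
open import Data.Vec.Functional using (Vector; tail)
open import Function.Base using (_∘_; id)
open import Function.Bundles using (_↔_; mk↔ₛ′; module Inverse)
open import Function.Construct.Composition using (_↔-∘_)
open import Function.Construct.Identity using (↔-id)
open import Level using (0ℓ)
open import Relation.Binary.Core using (Rel)
open import Relation.Binary.Definitions using (Decidable; Symmetric; Irreflexive)
open import Relation.Binary.PropositionalEquality
  using (_≡_; _≢_; refl; sym; subst₂; cong)
open import Relation.Nullary using (¬_; yes; no; contradiction)
open import Relation.Nullary.Decidable using (map′; ¬?; _→-dec_; _×-dec_)
import Relation.Unary as U

open Algebra.Properties.Monoid.Sum ℕ.+-0-monoid using (sum)

record Graph : Set₁ where
  field
    order  : ℕ
    Adj    : Rel (Fin order) 0ℓ
    adj?   : Decidable Adj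
    symm   : Symmetric Adj
    irrefl : Irreflexive _≡_ Adj

  Vertex : Set
  Vertex = Fin order

open Graph

TriangleFree : Graph → Set
TriangleFree G = ∀ {x y z} → Adj G x y → Adj G y z → ¬ Adj G x z

complete : ℕ → Graph
complete n = record
  { order  = n
  ; Adj    = _≢_
  ; adj?   = λ x y → ¬? (x ≟ y)
  ; symm   = λ x≢y y≡x → x≢y (sym y≡x)
  ; irrefl = λ x≡y x≢y → x≢y x≡y
  }

Proper : (G : Graph) {k : ℕ} → (Vertex G → Fin k) → Set
Proper G c = ∀ x y → Adj G x y → c x ≢ c y

Colourable : Graph → ℕ → Set
Colourable G k = ∃ λ (c : Vertex G → Fin k) → Proper G c

IsChromaticNumber : Graph → ℕ → Set
IsChromaticNumber G k = Colourable G k × (∀ {j} → Colourable G j → k ℕ.≤ j)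

proper? : (G : Graph) {k : ℕ} → U.Decidable (Proper G {k})
proper? G c = all? λ x → all? λ y → adj? G x y →-dec ¬? (c x ≟ c y)

colourable? : (G : Graph) → U.Decidable (Colourable G)
colourable? G k = map′
  (λ (i , p) → finToFun i , p)
  (λ (c , p) → funToFin c , λ x y xy e →
    p x y xy (subst₂ _≡_ (finToFun-funToFin c x) (finToFun-funToFin c y) e))
  (any? {n = k ℕ.^ order G} λ i → proper? G (finToFun i))

private
  least : {P : U.Pred ℕ 0ℓ} → U.Decidable P → ∀ n → P n →
          ∃ λ k → P k × (∀ {j} → P j → k ℕ.≤ j)
  least P? zero pn = zero , pn , λ _ → z≤n
  least {P} P? (suc n) pn with P? zero
  ... | yes p0 = zero , p0 , λ _ → z≤n
  ... | no ¬p0 with least (P? ∘ suc) n pn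
  ...   | k , pk , min = suc k , pk , bound
    where
    bound : ∀ {j} → P j → suc k ℕ.≤ j
    bound {zero}  p0 = contradiction p0 ¬p0
    bound {suc j} pj = s≤s (min pj)

chromaticNumber : (G : Graph) → ∃ (IsChromaticNumber G)
chromaticNumber G = least (colourable? G) (order G)
  (id , λ x y xy x≡y → irrefl G x≡y xy)

χ : Graph → ℕ
χ = proj₁ ∘ chromaticNumber

IsClique : (G : Graph) → Subset (order G) → Set
IsClique G S = ∀ x y → x ∈ S → y ∈ S → x ≢ y → Adj G x y

IsCliqueNumber : Graph → ℕ → Set
IsCliqueNumber G k = (∃ λ S → IsClique G S × ∣ S ∣ ≡ k)
                   × (∀ {S} → IsClique G S → ∣ S ∣ ℕ.≤ k)

isClique? : (G : Graph) → U.Decidable (IsClique G)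
isClique? G S = all? λ x → all? λ y →
  (x ∈? S) →-dec ((y ∈? S) →-dec (¬? (x ≟ y) →-dec adj? G x y))

private
  largest : (G : Graph) → ∀ n → (∀ {S} → IsClique G S → ∣ S ∣ ℕ.≤ n) →
            ∃ (IsCliqueNumber G)
  largest G zero    max =
    zero , (⊥ , (λ _ _ x∈⊥ → contradiction x∈⊥ ∉⊥) , ∣⊥∣≡0 (order G)) , max
  largest G (suc n) max
    with anySubset? (λ S → isClique? G S ×-dec (∣ S ∣ ℕ.≟ suc n))
  ... | yes found = suc n , found , max
  ... | no  none  = largest G n λ {S} S-clique →
    ℕ.s≤s⁻¹ (ℕ.≤∧≢⇒< (max S-clique) λ e → none (S , S-clique , e))

cliqueNumber : (G : Graph) → ∃ (IsCliqueNumber G)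
cliqueNumber G = largest G (order G) λ {S} _ → ∣p∣≤n S

ω : Graph → ℕ
ω = proj₁ ∘ cliqueNumber

blocks : ∀ {n} (a : Vector ℕ n) → Fin (sum a) ↔ Σ (Fin n) (Fin ∘ a)
blocks {zero}  a = mk↔ₛ′ (λ ()) (λ ()) (λ ()) (λ ())
blocks {suc n} a = cons ↔-∘ ((↔-id _ ⊎-↔ blocks (tail a)) ↔-∘ +↔⊎)
  where
  cons : (Fin (a zero) ⊎ Σ (Fin n) (Fin ∘ tail a)) ↔ Σ (Fin (suc n)) (Fin ∘ a)
  cons = mk↔ₛ′
    [ (λ x → zero , x) , (λ (v , x) → suc v , x) ]′
    (λ { (zero , x) → inj₁ x ; (suc v , x) → inj₂ (v , x) })
    (λ { (zero , x) → refl   ; (suc v , x) → refl })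
    (λ { (inj₁ x)   → refl   ; (inj₂ _)    → refl })

-- Substituting every vertex v of H by the graph K v, all at once: a vertex
-- (v , x) is the vertex x of the copy of K v that takes the place of v.
-- Substituting them one after another, in any order, gives the same graph up
-- to isomorphism.
module _ (H : Graph) (K : Vertex H → Graph) where

  data SubstAdj : Rel (Σ (Vertex H) (Vertex ∘ K)) 0ℓ where
    within : ∀ {v x y} → Adj (K v) x y → SubstAdj (v , x) (v , y)
    across : ∀ {u v x y} → Adj H u v → SubstAdj (u , x) (v , y)

  substAdj? : Decidable SubstAdj
  substAdj? (u , x) (v , y) with adj? H u v
  ... | yes uv = yes (across uv)
  ... | no ¬uv with u ≟ v
  ...   | no u≢v = no λ { (within _) → u≢v refl ; (across uv) → ¬uv uv }
  ...   | yes refl = map′ within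
          (λ { (within xy) → xy ; (across uv) → contradiction uv ¬uv })
          (adj? (K u) x y)

  substAdj-sym : Symmetric SubstAdj
  substAdj-sym (within xy) = within (symm (K _) xy)
  substAdj-sym (across uv) = across (symm H uv)

  substAdj-irrefl : Irreflexive _≡_ SubstAdj
  substAdj-irrefl refl (within xx) = irrefl (K _) refl xx
  substAdj-irrefl refl (across vv) = irrefl H refl vv

  substitute : Graph
  substitute = record
    { order  = sum (order ∘ K)
    ; Adj    = λ i j → SubstAdj (to i) (to j)
    ; adj?   = λ i j → substAdj? (to i) (to j)
    ; symm   = substAdj-sym
    ; irrefl = λ i≡j → substAdj-irrefl (cong to i≡j)
    }
    where open Inverse (blocks (order ∘ K)) using (to)

cliqueBlowup : (H : Graph) → (Vertex H → ℕ) → Graph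
cliqueBlowup H a = substitute H (complete ∘ a)

fromℕ : ℕ → ℚ
fromℕ n = + n / 1

χ-Bounded : (p q : ℕ) .{{_ : ℕ.NonZero q}} → Graph → Set
χ-Bounded p q G = + χ G ℤ.≤ ℚ.ceiling (p/2q ℚ.* fromℕ (ω G))
  where
  p/2q : ℚ
  p/2q = (+ p / (2 ℕ.* q)) {{ℕ.m*n≢0 2 q}}

-- The numerator is an integer, so p - q - 2 is not truncated; the
-- denominator is a natural number, and p > 2 q makes ∸ exact there.
threshold : (p q : ℕ) → p ℕ.> 2 ℕ.* q → ℚ
threshold p q p>2q = fraction ℚ.⊔ fromℕ (2 ℕ.* q)
  where
  fraction : ℚ
  fraction = ((+ (2 ℕ.* q) ℤ.* (+ p ℤ.- + q ℤ.- + 2)) / (p ℕ.∸ 2 ℕ.* q))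
    {{ℕ.>-nonZero (ℕ.m<n⇒0<n∸m p>2q)}}

{-# OPTIONS --safe #-}

-- Let a be the weights of a blowup A of F, and m v the largest weight of a
-- neighbour of v. Split a = b + c with b v = min (a v) (max q (2q − m v)).
-- Then the blowup B by b has ω(B) ≤ 2q, and if ω(A) > 2q, the blowup C by c
-- has ω(C) ≤ ω(A) − 2q; both follow by looking at the edges only, since F is
-- triangle-free. Hence χ(A) ≤ χ(B) + χ(C) ≤ p + ⌈p/2q (ω(A) − 2q)⌉, which is
-- ⌈p/2q ω(A)⌉, by induction on ω(A).

module Submission where

open import Defs
open import Data.Nat.Base using (ℕ; NonZero; _*_; _>_)
open import Data.Rational.Base using (_≤_)
open import Function.Bundles using (_⇔_)

open import Data.Fin.Base using (Fin; zero; suc; inject≤; splitAt; join)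
open import Data.Fin.Properties
  using (_≟_; all?; suc-injective; injective⇒≤; inject≤-injective; ¬∀⟶∃¬; +↔⊎)
open import Data.Fin.Subset
  using (Subset; inside; outside; _∈_; ∣_∣; ⊥; ⁅_⁆; _∪_)
open import Data.Fin.Subset.Properties
  using (∉⊥; x∈⁅x⁆; x∈⁅y⁆⇒x≡y; x∈p∪q⁻; p⊆p∪q; q⊆p∪q; p⊂q⇒∣p∣<∣q∣)
open import Data.Integer.Base as ℤ using (ℤ)
import Data.Integer.DivMod as ℤ
import Data.Integer.Properties as ℤ
import Data.Integer.Tactic.RingSolver as ℤ-Solver
open import Data.List.Base using (map; filter; allFin)
open import Data.List.Extrema.Nat using (max; xs≤max; max≤v⁺)
open import Data.List.Membership.Propositional.Properties
  using (∈-map⁺; ∈-filter⁺; ∈-allFin)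
import Data.List.Relation.Unary.All as All
import Data.List.Relation.Unary.All.Properties as All
open import Data.Nat.Base as ℕ using (zero; suc; _+_; _∸_; _⊓_; _⊔_; z≤n)
open import Data.Nat.Induction using (<-wellFounded)
import Data.Nat.Properties as ℕ
import Data.Nat.Tactic.RingSolver as ℕ-Solver
open import Data.Product.Base using (Σ; ∃; _×_; _,_; proj₁; proj₂)
open import Data.Rational.Base as ℚ using (ℚ; ↥_; ↧_; toℚᵘ; floor; ceiling)
import Data.Rational.Properties as ℚ
open import Data.Rational.Unnormalised.Base as ℚᵘ using (mkℚᵘ; *≡*)
import Data.Rational.Unnormalised.Properties as ℚᵘ
open import Data.Sum.Base as Sum using (_⊎_; inj₁; inj₂; [_,_]′)
open import Data.Sum.Properties using (inj₁-injective; inj₂-injective)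
open import Data.Vec.Base using ([]; _∷_; here; there)
open import Function.Base using (_∘_)
open import Function.Bundles
  using (mk⇔; module Equivalence; module Injection; module Inverse)
open import Function.Properties.Inverse using (↔-sym; ↔⇒↣)
open import Function.Definitions using (Injective)
open import Induction.WellFounded using (Acc; acc)
open import Level using (0ℓ)
open import Relation.Binary.Core using (Rel)
open import Relation.Binary.Definitions using (Irreflexive)
open import Relation.Binary.PropositionalEquality
open import Relation.Nullary using (yes; no; contradiction)

open Graph

private
  variable
    k m n : ℕ

-- Finite subsets and injective enumerations.

image : (Fin k → Fin n) → Subset n
image {zero}  f = ⊥
image {suc k} f = ⁅ f zero ⁆ ∪ image (f ∘ suc)

∈-image⁻ : ∀ (f : Fin k → Fin n) {x} → x ∈ image f → ∃ λ i → f i ≡ x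
∈-image⁻ {zero}  f x∈ = contradiction x∈ ∉⊥
∈-image⁻ {suc k} f x∈ with x∈p∪q⁻ _ _ x∈
... | inj₁ x∈⁅f0⁆ = zero , sym (x∈⁅y⁆⇒x≡y _ x∈⁅f0⁆)
... | inj₂ x∈im   = let (i , fi≡x) = ∈-image⁻ (f ∘ suc) x∈im in suc i , fi≡x

-- By injectivity `f zero` is not in the image of the remaining indices, so adjoining it enlarges
-- that image strictly.
∣image∣≥ : ∀ (f : Fin k → Fin n) → Injective _≡_ _≡_ f → k ℕ.≤ ∣ image f ∣
∣image∣≥ {zero}  f inj = z≤n
∣image∣≥ {suc k} f inj = ℕ.≤-<-trans
  (∣image∣≥ (f ∘ suc) (suc-injective ∘ inj))
  (p⊂q⇒∣p∣<∣q∣ ( q⊆p∪q _ _ , f zero , p⊆p∪q _ (x∈⁅x⁆ _)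
               , λ f0∈ → let (i , eq) = ∈-image⁻ (f ∘ suc) f0∈ in
                          contradiction (inj eq) λ () ))

elements : (S : Subset n) → Fin ∣ S ∣ → Fin n
elements (inside  ∷ S) zero    = zero
elements (inside  ∷ S) (suc i) = suc (elements S i)
elements (outside ∷ S) i       = suc (elements S i)

elements-∈ : (S : Subset n) (i : Fin ∣ S ∣) → elements S i ∈ S
elements-∈ (inside  ∷ S) zero    = here
elements-∈ (inside  ∷ S) (suc i) = there (elements-∈ S i)
elements-∈ (outside ∷ S) i       = there (elements-∈ S i)

elements-injective : (S : Subset n) → Injective _≡_ _≡_ (elements S)
elements-injective (inside  ∷ S) {zero}  {zero}  eq = refl
elements-injective (inside  ∷ S) {suc i} {suc j} eq =
  cong suc (elements-injective S (suc-injective eq))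
elements-injective (outside ∷ S) eq = elements-injective S (suc-injective eq)

splitAt-injective : Injective _≡_ _≡_ (splitAt m {n})
splitAt-injective = Injection.injective (↔⇒↣ +↔⊎)

join-injective : Injective _≡_ _≡_ (join m n)
join-injective = Injection.injective (↔⇒↣ (↔-sym +↔⊎))

-- Cliques as families of pairwise related elements.

Pairwise : ∀ {A : Set} → Rel A 0ℓ → (Fin k → A) → Set
Pairwise R f = ∀ i j → i ≢ j → R (f i) (f j)

pairwise-injective : ∀ {A : Set} {R : Rel A 0ℓ} {f : Fin k → A} →
                     Irreflexive _≡_ R → Pairwise R f → Injective _≡_ _≡_ f
pairwise-injective irr Rf {i} {j} fi≡fj with i ≟ j
... | yes i≡j = i≡j
... | no  i≢j = contradiction (Rf i j i≢j) (irr fi≡fj)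

-- Irreflexivity of adjacency makes `f` injective, so its image is a clique with at least `k`
-- elements.
pairwiseAdjacent⇒≤ω : ∀ G (f : Fin k → Vertex G) → Pairwise (Adj G) f → k ℕ.≤ ω G
pairwiseAdjacent⇒≤ω G f adj = ℕ.≤-trans
  (∣image∣≥ f (pairwise-injective (irrefl G) adj))
  (proj₂ (proj₂ (cliqueNumber G)) clique)
  where
  clique : IsClique G (image f)
  clique x y x∈ y∈ x≢y with ∈-image⁻ f x∈ | ∈-image⁻ f y∈
  ... | i , refl | j , refl = adj i j λ i≡j → x≢y (cong f i≡j)

maximumClique : ∀ G → ∃ λ (f : Fin (ω G) → Vertex G) → Pairwise (Adj G) f
maximumClique G with cliqueNumber G
... | _ , (S , clique , refl) , _ = elements S , λ i j i≢j →
  clique _ _ (elements-∈ S i) (elements-∈ S j) (i≢j ∘ elements-injective S)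

-- Clique numbers and colourings of clique blowups.

IsEdgeBound : (H : Graph) → (Vertex H → ℕ) → ℕ → Set
IsEdgeBound H a k = (∀ v → a v ℕ.≤ k)
                  × (∀ {u v} → Adj H u v → a u + a v ℕ.≤ k)

module _ (H : Graph) (a : Vertex H → ℕ) where

  open Inverse (blocks a)
    renaming (to to toBlock; from to fromBlock; strictlyInverseˡ to toBlock∘fromBlock)
    using ()

  private
    B : Graph
    B = cliqueBlowup H a

    BlowupVertex : Set
    BlowupVertex = Σ (Vertex H) (Fin ∘ a)

    BlowupAdj : Rel BlowupVertex 0ℓ
    BlowupAdj = SubstAdj H (complete ∘ a)

    fromBlock-adj : ∀ {s t} → BlowupAdj s t → Adj B (fromBlock s) (fromBlock t)
    fromBlock-adj {s} {t} = subst₂ BlowupAdj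
      (sym (toBlock∘fromBlock s)) (sym (toBlock∘fromBlock t))

    adj⇒≤ω : (g : Fin k → BlowupVertex) → Pairwise BlowupAdj g → k ℕ.≤ ω B
    adj⇒≤ω g adj = pairwiseAdjacent⇒≤ω B (fromBlock ∘ g)
      λ i j i≢j → fromBlock-adj (adj i j i≢j)

  -- The block over a vertex is a clique, and so is the union of the blocks over the two ends of an
  -- edge. With `ω-least-edgeBound` this makes `ω` of the blowup the least edge bound when `H` is
  -- triangle-free.
  ω-isEdgeBound : IsEdgeBound H a (ω B)
  ω-isEdgeBound =
      (λ v → adj⇒≤ω (v ,_) λ _ _ → within)
    , λ {u} {v} uv → adj⇒≤ω (vertex u v ∘ splitAt (a u))
        λ i j i≢j → adjacent uv _ _ (i≢j ∘ splitAt-injective)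
    where
    vertex : ∀ u v → Fin (a u) ⊎ Fin (a v) → BlowupVertex
    vertex u v = [ u ,_ , v ,_ ]′

    adjacent : ∀ {u v} → Adj H u v → ∀ s t → s ≢ t →
               BlowupAdj (vertex u v s) (vertex u v t)
    adjacent uv (inj₁ x) (inj₁ y) s≢t = within (s≢t ∘ cong inj₁)
    adjacent uv (inj₁ x) (inj₂ y) s≢t = across uv
    adjacent uv (inj₂ x) (inj₁ y) s≢t = across (symm H uv)
    adjacent uv (inj₂ x) (inj₂ y) s≢t = within (s≢t ∘ cong inj₂)

  -- Members of a clique in distinct blocks lie over adjacent vertices of `H`. As `H` has no
  -- triangle, at most two blocks are met, and the clique injects into one block or into the
  -- disjoint union of two.
  ω-least-edgeBound : TriangleFree H → IsEdgeBound H a k → ω B ℕ.≤ k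
  ω-least-edgeBound {k} tf (a≤k , a+a≤k) =
    let (f , adj) = maximumClique B in clique≤ (toBlock ∘ f) adj
    where
    adj-blocks : ∀ {s t} → BlowupAdj s t → proj₁ s ≢ proj₁ t →
                 Adj H (proj₁ s) (proj₁ t)
    adj-blocks (within _)  v≢v = contradiction refl v≢v
    adj-blocks (across uv) _   = uv

    place : ∀ {u v} (s : BlowupVertex) → proj₁ s ≡ u ⊎ proj₁ s ≡ v →
            Fin (a u) ⊎ Fin (a v)
    place (_ , x) (inj₁ refl) = inj₁ x
    place (_ , x) (inj₂ refl) = inj₂ x

    place-injective : ∀ {u v} s t (p : proj₁ s ≡ u ⊎ proj₁ s ≡ v) q →
                      place s p ≡ place t q → s ≡ t
    place-injective _ _ (inj₁ refl) (inj₁ refl) refl = refl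
    place-injective _ _ (inj₂ refl) (inj₂ refl) refl = refl
    place-injective _ _ (inj₁ refl) (inj₂ refl) ()
    place-injective _ _ (inj₂ refl) (inj₁ refl) ()

    only : ∀ {u} (s : BlowupVertex) → proj₁ s ≡ u → Fin (a u)
    only (_ , x) refl = x

    only-injective : ∀ {u} s t (p : proj₁ s ≡ u) q → only s p ≡ only t q → s ≡ t
    only-injective _ _ refl refl refl = refl

    clique≤ : (g : Fin m → BlowupVertex) → Pairwise BlowupAdj g → m ℕ.≤ k
    clique≤ {zero}  g adj = z≤n
    -- The block of `g zero` is the reference: either it contains the whole clique, or some `g i`
    -- outside it provides an edge of `H`.
    clique≤ {suc m} g adj with all? (λ i → proj₁ (g i) ≟ proj₁ (g zero))
    ... | yes same = ℕ.≤-trans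
      (injective⇒≤ {f = λ i → only (g i) (same i)}
        (pairwise-injective (substAdj-irrefl H (complete ∘ a)) adj
          ∘ only-injective _ _ (same _) (same _)))
      (a≤k _)
    ... | no ¬same with ¬∀⟶∃¬ _ _ (λ i → proj₁ (g i) ≟ proj₁ (g zero)) ¬same
    ...   | i , v≢u = ℕ.≤-trans
      (injective⇒≤ {f = λ j → join _ _ (place (g j) (near j))}
        (pairwise-injective (substAdj-irrefl H (complete ∘ a)) adj
          ∘ place-injective _ _ (near _) (near _) ∘ join-injective))
      (a+a≤k uv)
      where
      distinct : ∀ {j l} → proj₁ (g j) ≢ proj₁ (g l) →
                 Adj H (proj₁ (g j)) (proj₁ (g l))
      distinct neq = adj-blocks (adj _ _ (neq ∘ cong (proj₁ ∘ g))) neq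

      uv : Adj H (proj₁ (g zero)) (proj₁ (g i))
      uv = distinct (v≢u ∘ sym)

      near : ∀ j → proj₁ (g j) ≡ proj₁ (g zero) ⊎ proj₁ (g j) ≡ proj₁ (g i)
      near j with proj₁ (g j) ≟ proj₁ (g zero) | proj₁ (g j) ≟ proj₁ (g i)
      ... | yes w≡u | _       = inj₁ w≡u
      ... | no  _   | yes w≡v = inj₂ w≡v
      -- A third block would give a triangle on `w`, `u` and `v`.
      ... | no  w≢u | no  w≢v =
        contradiction (distinct w≢v) (tf (distinct w≢u) uv)

  -- Optimal colourings are moved to the coordinates `(v , x)`, where the block of a vertex is
  -- visible, instead of indices in `Fin (sum a)`.
  blowup-colouring : ∃ λ (c : BlowupVertex → Fin (χ B)) →
                     ∀ {s t} → BlowupAdj s t → c s ≢ c t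
  blowup-colouring =
    let (c , proper) , _ = proj₂ (chromaticNumber B) in
    c ∘ fromBlock , proper _ _ ∘ fromBlock-adj

  blowup-colouring⇒χ≤ : (c : BlowupVertex → Fin k) →
                        (∀ {s t} → BlowupAdj s t → c s ≢ c t) → χ B ℕ.≤ k
  blowup-colouring⇒χ≤ c proper =
    proj₂ (proj₂ (chromaticNumber B)) (c ∘ toBlock , λ _ _ → proper)

-- Each block of weight `a v` embeds into disjoint blocks of weights `b v` and `c v`. Optimal
-- colourings of the two smaller blowups, used with disjoint palettes, then colour the whole.
χ-subadditive : ∀ H {a b c} → (∀ v → a v ℕ.≤ b v + c v) →
  χ (cliqueBlowup H a) ℕ.≤ χ (cliqueBlowup H b) + χ (cliqueBlowup H c)
χ-subadditive H {a} {b} {c} a≤b+c = blowup-colouring⇒χ≤ H a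
  (λ (v , x) → join _ _ (colour v (split v x)))
  λ st → proper st ∘ join-injective
  where
  β-colouring = blowup-colouring H b
  γ-colouring = blowup-colouring H c
  β = proj₁ β-colouring
  γ = proj₁ γ-colouring

  split : ∀ v → Fin (a v) → Fin (b v) ⊎ Fin (c v)
  -- The first `b v` elements of the block go to the first part, any others to the second.
  split v x = splitAt (b v) (inject≤ x (a≤b+c v))

  split-injective : ∀ v → Injective _≡_ _≡_ (split v)
  split-injective v = inject≤-injective _ _ _ _ ∘ splitAt-injective

  colour : ∀ v → Fin (b v) ⊎ Fin (c v) →
           Fin (χ (cliqueBlowup H b)) ⊎ Fin (χ (cliqueBlowup H c))
  colour v = Sum.map (β ∘ (v ,_)) (γ ∘ (v ,_))

  colour-within : ∀ {v} s t → s ≢ t → colour v s ≢ colour v t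
  colour-within (inj₁ x) (inj₁ y) s≢t =
    proj₂ β-colouring (within (s≢t ∘ cong inj₁)) ∘ inj₁-injective
  colour-within (inj₁ x) (inj₂ y) s≢t ()
  colour-within (inj₂ x) (inj₁ y) s≢t ()
  colour-within (inj₂ x) (inj₂ y) s≢t =
    proj₂ γ-colouring (within (s≢t ∘ cong inj₂)) ∘ inj₂-injective

  colour-across : ∀ {u v} → Adj H u v → ∀ s t → colour u s ≢ colour v t
  colour-across uv (inj₁ x) (inj₁ y) = proj₂ β-colouring (across uv) ∘ inj₁-injective
  colour-across uv (inj₁ x) (inj₂ y) ()
  colour-across uv (inj₂ x) (inj₁ y) ()
  colour-across uv (inj₂ x) (inj₂ y) = proj₂ γ-colouring (across uv) ∘ inj₂-injective

  proper : ∀ {u v x y} → SubstAdj H (complete ∘ a) (u , x) (v , y) →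
           colour u (split u x) ≢ colour v (split v y)
  proper (within x≢y) = colour-within (split _ _) (split _ _) (x≢y ∘ split-injective _)
  proper (across uv)  = colour-across uv (split _ _) (split _ _)

-- Splitting the weights at `cut`.

module _ (H : Graph) (a : Vertex H → ℕ) where

  -- The default `0` is the value at an isolated vertex.
  maxNeighbour : Vertex H → ℕ
  maxNeighbour v = max 0 (map a (filter (adj? H v) (allFin _)))

  neighbour≤max : ∀ {u v} → Adj H v u → a u ℕ.≤ maxNeighbour v
  neighbour≤max {u} {v} vu =
    All.lookup (xs≤max 0 (map a (filter (adj? H v) (allFin _))))
      (∈-map⁺ a (∈-filter⁺ (adj? H v) (∈-allFin u) vu))

  -- Every neighbour has weight at most `k ∸ a v`, hence so does the heaviest one. The bound
  -- `a v ≤ k` makes this subtraction exact and also covers isolated vertices.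
  maxNeighbour-edgeBound : ∀ {k} → IsEdgeBound H a k → ∀ v → maxNeighbour v + a v ℕ.≤ k
  maxNeighbour-edgeBound {k} (a≤k , a+a≤k) v = ℕ.m≤o∸n⇒m+n≤o (maxNeighbour v) (a≤k v)
    (max≤v⁺ z≤n (All.map⁺ (All.map
      (ℕ.m+n≤o⇒m≤o∸n _ ∘ a+a≤k ∘ symm H)
      (All.all-filter (adj? H v) (allFin _)))))

  module _ (q : ℕ) where

    -- The term `q` makes the two ends of a heavy edge lose `2 * q` together. The other term ensures
    -- `2 * q ≤ maxNeighbour v + cut v`, which controls single vertices. Truncation to `0` is
    -- harmless under the maximum with `q`.
    cut : Vertex H → ℕ
    cut v = q ⊔ (2 * q ∸ maxNeighbour v)

    removed remaining : Vertex H → ℕ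
    removed   v = cut v ⊓ a v
    remaining v = a v ∸ cut v

    a≤removed+remaining : ∀ v → a v ℕ.≤ removed v + remaining v
    a≤removed+remaining v = ℕ.≤-reflexive (sym (ℕ.m⊓n+n∸m≡n (cut v) (a v)))

    cut≤2q : ∀ v → cut v ℕ.≤ 2 * q
    cut≤2q v = ℕ.⊔-lub (ℕ.m≤n*m q 2) (ℕ.m∸n≤m (2 * q) (maxNeighbour v))

    -- If `a u ≤ q`, then `u` contributes at most `a u`, and its neighbour `v` at most
    -- `cut v ≤ 2 * q ∸ a u`. If both ends weigh at least `q`, each has a neighbour of weight at
    -- least `q`, which brings both cuts down to `q`.
    removed-isEdgeBound : IsEdgeBound H removed (2 * q)
    removed-isEdgeBound = (λ v → ℕ.≤-trans (ℕ.m⊓n≤m _ _) (cut≤2q v)) , edge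
      where
      light : ∀ {u v} → Adj H u v → a u ℕ.≤ q → removed u + removed v ℕ.≤ 2 * q
      light {u} {v} uv au≤q = begin
        removed u + removed v   ≤⟨ ℕ.+-mono-≤ (ℕ.m⊓n≤n (cut u) _) (ℕ.m⊓n≤m _ (a v)) ⟩
        a u + cut v             ≤⟨ ℕ.+-monoʳ-≤ (a u) cut≤ ⟩
        a u + (2 * q ∸ a u)     ≡⟨ ℕ.m+[n∸m]≡n (ℕ.≤-trans au≤q (ℕ.m≤n*m q 2)) ⟩
        2 * q                   ∎
        where
        open ℕ.≤-Reasoning
        q≤ : q ℕ.≤ 2 * q ∸ a u
        q≤ = ℕ.m+n≤o⇒m≤o∸n q (begin
          q + a u   ≤⟨ ℕ.+-monoʳ-≤ q au≤q ⟩
          q + q     ≡⟨ cong (q +_) (ℕ.+-identityʳ q) ⟨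
          2 * q     ∎)

        cut≤ : cut v ℕ.≤ 2 * q ∸ a u
        cut≤ = ℕ.⊔-lub q≤ (ℕ.∸-monoʳ-≤ (2 * q) (neighbour≤max (symm H uv)))

      heavy : ∀ {u v} → Adj H v u → q ℕ.≤ a u → removed v ℕ.≤ q
      heavy {u} {v} vu q≤au = ℕ.≤-trans (ℕ.m⊓n≤m _ (a v)) (ℕ.⊔-lub ℕ.≤-refl (begin
        2 * q ∸ maxNeighbour v   ≤⟨ ℕ.∸-monoʳ-≤ (2 * q) (ℕ.≤-trans q≤au (neighbour≤max vu)) ⟩
        2 * q ∸ q                ≡⟨ ℕ.m+n∸m≡n q (q + 0) ⟩
        q + 0                    ≡⟨ ℕ.+-identityʳ q ⟩
        q                        ∎))
        where open ℕ.≤-Reasoning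

      edge : ∀ {u v} → Adj H u v → removed u + removed v ℕ.≤ 2 * q
      edge {u} {v} uv with ℕ.≤-total (a u) q | ℕ.≤-total (a v) q
      ... | inj₁ au≤q | _         = light uv au≤q
      ... | inj₂ _    | inj₁ av≤q =
        subst (ℕ._≤ 2 * q) (ℕ.+-comm (removed v) _) (light (symm H uv) av≤q)
      ... | inj₂ q≤au | inj₂ q≤av =
        subst (removed u + removed v ℕ.≤_) (cong (q +_) (sym (ℕ.+-identityʳ q)))
          (ℕ.+-mono-≤ (heavy uv q≤av) (heavy (symm H uv) q≤au))

    -- At a single vertex, `maxNeighbour v + a v ≤ 2 * q + k` is compared with
    -- `2 * q ≤ maxNeighbour v + cut v`. On an edge, an end of weight at most `q` disappears,
    -- leaving the vertex bound for the other; two heavier ends lose at least `q` each.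
    remaining-isEdgeBound : ∀ {k} → IsEdgeBound H a (2 * q + k) → IsEdgeBound H remaining k
    remaining-isEdgeBound {k} bound@(_ , a+a≤) = vertex , edge
      where
      open ℕ.≤-Reasoning

      vertex : ∀ v → remaining v ℕ.≤ k
      vertex v = ℕ.m≤n+o⇒m∸n≤o (a v) (cut v) (ℕ.+-cancelˡ-≤ (maxNeighbour v) _ _ (begin
        maxNeighbour v + a v             ≤⟨ maxNeighbour-edgeBound bound v ⟩
        2 * q + k                        ≤⟨ ℕ.+-monoˡ-≤ k 2q≤m+cut ⟩
        maxNeighbour v + cut v + k       ≡⟨ ℕ.+-assoc (maxNeighbour v) _ _ ⟩
        maxNeighbour v + (cut v + k)     ∎))
        where
        2q≤m+cut : 2 * q ℕ.≤ maxNeighbour v + cut v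
        2q≤m+cut = ℕ.≤-trans (ℕ.m≤n+m∸n (2 * q) (maxNeighbour v))
          (ℕ.+-monoʳ-≤ (maxNeighbour v) (ℕ.m≤n⊔m q _))

      light : ∀ {u v} → a u ℕ.≤ q → remaining u + remaining v ℕ.≤ k
      light {u} {v} au≤q = subst (λ r → r + remaining v ℕ.≤ k)
        (sym (ℕ.m≤n⇒m∸n≡0 (ℕ.≤-trans au≤q (ℕ.m≤m⊔n q _)))) (vertex v)

      heavy : ∀ {v} → q ℕ.≤ a v → q + remaining v ℕ.≤ a v
      heavy {v} q≤av = begin
        q + remaining v   ≤⟨ ℕ.+-monoʳ-≤ q (ℕ.∸-monoʳ-≤ (a v) (ℕ.m≤m⊔n q _)) ⟩
        q + (a v ∸ q)     ≡⟨ ℕ.m+[n∸m]≡n q≤av ⟩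
        a v               ∎

      edge : ∀ {u v} → Adj H u v → remaining u + remaining v ℕ.≤ k
      edge {u} {v} uv with ℕ.≤-total (a u) q | ℕ.≤-total (a v) q
      ... | inj₁ au≤q | _         = light au≤q
      ... | inj₂ _    | inj₁ av≤q =
        subst (ℕ._≤ k) (ℕ.+-comm (remaining v) _) (light av≤q)
      ... | inj₂ q≤au | inj₂ q≤av = ℕ.+-cancelˡ-≤ (2 * q) _ _ (begin
        2 * q + (remaining u + remaining v)     ≡⟨ regroup q _ _ ⟩
        (q + remaining u) + (q + remaining v)   ≤⟨ ℕ.+-mono-≤ (heavy q≤au) (heavy q≤av) ⟩
        a u + a v                               ≤⟨ a+a≤ uv ⟩
        2 * q + k                               ∎)
        where
        regroup : ∀ q x y → 2 * q + (x + y) ≡ (q + x) + (q + y)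
        regroup = ℕ-Solver.solve-∀

-- Ceilings of rationals, cleared of denominators.

floor-lower : ∀ x → floor x ℤ.* ↧ x ℤ.≤ ↥ x
floor-lower x@record{} = ℤ.[n/d]*d≤n (↥ x) (↧ x)

floor-upper : ∀ x → ↥ x ℤ.< ℤ.suc (floor x) ℤ.* ↧ x
floor-upper x@record{} = subst (λ z → ↥ x ℤ.< ℤ.suc z ℤ.* ↧ x)
  (sym (ℤ.div-pos-is-/ℕ (↥ x) (ℚ.↧ₙ x))) (ℤ.n<s[n/ℕd]*d (↥ x) (ℚ.↧ₙ x))

ceiling≡-floor- : ∀ x → ceiling x ≡ ℤ.- floor (ℚ.- x)
ceiling≡-floor- record{} = refl

ceiling-upper : ∀ x → ↥ x ℤ.≤ ceiling x ℤ.* ↧ x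
ceiling-upper x = begin
  ↥ x                               ≡⟨ ℤ.neg-involutive (↥ x) ⟨
  ℤ.- (ℤ.- ↥ x)                     ≡⟨ cong ℤ.-_ (ℚ.↥-neg x) ⟨
  ℤ.- ↥ (ℚ.- x)                     ≤⟨ ℤ.neg-mono-≤ (floor-lower (ℚ.- x)) ⟩
  ℤ.- (floor (ℚ.- x) ℤ.* ↧ (ℚ.- x)) ≡⟨ ℤ.neg-distribˡ-* (floor (ℚ.- x)) _ ⟩
  ℤ.- floor (ℚ.- x) ℤ.* ↧ (ℚ.- x)   ≡⟨ cong₂ ℤ._*_ (sym (ceiling≡-floor- x)) (ℚ.↧-neg x) ⟩
  ceiling x ℤ.* ↧ x                 ∎
  where open ℤ.≤-Reasoning

-- Negating the upper estimate for the floor of `- x` gives `ceiling x < x + 1`.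
ceiling-lower : ∀ x → ceiling x ℤ.* ↧ x ℤ.< ↥ x ℤ.+ ↧ x
ceiling-lower x = begin-strict
  ceiling x ℤ.* ↧ x           ≡⟨ regroup (ceiling x) (↧ x) ⟩
  ↧ x ℤ.- upper               <⟨ ℤ.+-monoʳ-< (↧ x) (ℤ.neg-mono-< bound) ⟩
  ↧ x ℤ.- (ℤ.- ↥ x)           ≡⟨ cong (λ z → ↧ x ℤ.+ z) (ℤ.neg-involutive (↥ x)) ⟩
  ↧ x ℤ.+ ↥ x                 ≡⟨ ℤ.+-comm (↧ x) (↥ x) ⟩
  ↥ x ℤ.+ ↧ x                 ∎
  where
  open ℤ.≤-Reasoning
  upper = (ℤ.1ℤ ℤ.- ceiling x) ℤ.* ↧ x

  floor≡ : floor (ℚ.- x) ≡ ℤ.- ceiling x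
  floor≡ = trans (sym (ℤ.neg-involutive _)) (cong ℤ.-_ (sym (ceiling≡-floor- x)))

  bound : ℤ.- ↥ x ℤ.< upper
  bound = subst₂ ℤ._<_ (ℚ.↥-neg x)
    (cong₂ (λ z d → ℤ.suc z ℤ.* d) floor≡ (ℚ.↧-neg x)) (floor-upper (ℚ.- x))

  regroup : ∀ c d → c ℤ.* d ≡ d ℤ.- (ℤ.1ℤ ℤ.- c) ℤ.* d
  regroup = ℤ-Solver.solve-∀

-- The ceiling is traded for the strict inequality `n < x + 1`. Conversely, that inequality gives
-- `n < ceiling x + 1`, and integrality removes the `1`.
≤ceiling⇔ : ∀ x n → n ℤ.≤ ceiling x ⇔ n ℤ.* ↧ x ℤ.< ↥ x ℤ.+ ↧ x
≤ceiling⇔ x@record{} n = mk⇔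
  (λ n≤c → ℤ.≤-<-trans (ℤ.*-monoʳ-≤-nonNeg (↧ x) n≤c) (ceiling-lower x))
  λ nd<i+d → subst (n ℤ.≤_) (ℤ.pred-suc (ceiling x)) (ℤ.i<j⇒i≤pred[j]
    (ℤ.*-cancelʳ-<-nonNeg {n} {ℤ.suc (ceiling x)} (↧ x) (begin-strict
      n ℤ.* ↧ x                     <⟨ nd<i+d ⟩
      ↥ x ℤ.+ ↧ x                   ≤⟨ ℤ.+-monoˡ-≤ (↧ x) (ceiling-upper x) ⟩
      ceiling x ℤ.* ↧ x ℤ.+ ↧ x     ≡⟨ ℤ.+-comm (ceiling x ℤ.* ↧ x) (↧ x) ⟩
      ↧ x ℤ.+ ceiling x ℤ.* ↧ x     ≡⟨ ℤ.suc-* (ceiling x) (↧ x) ⟨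
      ℤ.suc (ceiling x) ℤ.* ↧ x     ∎)))
  where open ℤ.≤-Reasoning

-- Normalisation may cancel common factors, so numerator and denominator are known only up to
-- cross-multiplication. The equation is read off from unnormalised rationals.
scaled-fraction : ∀ i d .{{_ : NonZero d}} w →
  let x = (i ℚ./ d) ℚ.* fromℕ w in
  ↥ x ℤ.* ℤ.+ d ≡ (i ℤ.* ℤ.+ w) ℤ.* ↧ x
scaled-fraction i d@(suc e) w
  with *≡* eq ← ℚᵘ.≃-trans (ℚ.toℚᵘ-homo-* (i ℚ./ d) (fromℕ w))
    (ℚᵘ.*-cong (ℚ.toℚᵘ-fromℚᵘ (mkℚᵘ i e)) (ℚ.toℚᵘ-fromℚᵘ (mkℚᵘ (ℤ.+ w) 0)))
  = let x = (i ℚ./ d) ℚ.* fromℕ w in begin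
  ↥ x ℤ.* ℤ.+ d                           ≡⟨ cong₂ ℤ._*_ (ℚ.↥ᵘ-toℚᵘ x) (ℤ.*-identityʳ (ℤ.+ d)) ⟨
  ℚᵘ.↥ toℚᵘ x ℤ.* (ℤ.+ d ℤ.* ℤ.1ℤ)        ≡⟨ eq ⟩
  (i ℤ.* ℤ.+ w) ℤ.* ℚᵘ.↧ toℚᵘ x           ≡⟨ cong ((i ℤ.* ℤ.+ w) ℤ.*_) (ℚ.↧ᵘ-toℚᵘ x) ⟩
  (i ℤ.* ℤ.+ w) ℤ.* ↧ x                   ∎
  where open ≡-Reasoning

-- The criterion of `≤ceiling⇔` is independent of the fraction representing `x`: multiply by one
-- positive denominator and cancel the other.
≤ceiling-fraction⇔ : ∀ x i d .{{_ : NonZero d}} → ↥ x ℤ.* ℤ.+ d ≡ i ℤ.* ↧ x →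
                     ∀ n → n ℤ.≤ ceiling x ⇔ n ℤ.* ℤ.+ d ℤ.< i ℤ.+ ℤ.+ d
≤ceiling-fraction⇔ x@record{} i d@(suc _) eq n = mk⇔
  (λ n≤c → ℤ.*-cancelʳ-<-nonNeg (↧ x) (subst₂ ℤ._<_ left right
    (ℤ.*-monoʳ-<-pos (ℤ.+ d) (Equivalence.to (≤ceiling⇔ x n) n≤c))))
  (λ nd< → Equivalence.from (≤ceiling⇔ x n) (ℤ.*-cancelʳ-<-nonNeg (ℤ.+ d)
    (subst₂ ℤ._<_ (sym left) (sym right) (ℤ.*-monoʳ-<-pos (↧ x) nd<))))
  where
  left : (n ℤ.* ↧ x) ℤ.* ℤ.+ d ≡ (n ℤ.* ℤ.+ d) ℤ.* ↧ x
  left = swap n (↧ x) (ℤ.+ d)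
    where
    swap : ∀ i j l → (i ℤ.* j) ℤ.* l ≡ (i ℤ.* l) ℤ.* j
    swap = ℤ-Solver.solve-∀

  right : (↥ x ℤ.+ ↧ x) ℤ.* ℤ.+ d ≡ (i ℤ.+ ℤ.+ d) ℤ.* ↧ x
  right = begin
    (↥ x ℤ.+ ↧ x) ℤ.* ℤ.+ d             ≡⟨ ℤ.*-distribʳ-+ (ℤ.+ d) (↥ x) (↧ x) ⟩
    ↥ x ℤ.* ℤ.+ d ℤ.+ ↧ x ℤ.* ℤ.+ d     ≡⟨ cong₂ ℤ._+_ eq (ℤ.*-comm (↧ x) (ℤ.+ d)) ⟩
    i ℤ.* ↧ x ℤ.+ ℤ.+ d ℤ.* ↧ x         ≡⟨ ℤ.*-distribʳ-+ (↧ x) i (ℤ.+ d) ⟨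
    (i ℤ.+ ℤ.+ d) ℤ.* ↧ x               ∎
    where open ≡-Reasoning

-- Here `χ < p ω / 2q + 1` is multiplied by `2 * q`, so that the induction runs entirely in natural
-- numbers.
χ-Bounded⇔ : ∀ p q .{{_ : NonZero q}} G →
             χ-Bounded p q G ⇔ χ G * (2 * q) ℕ.< p * ω G + 2 * q
χ-Bounded⇔ p q G = mk⇔
  (λ bounded → ℤ.drop‿+<+ (subst₂ ℤ._<_ (sym left) (sym right)
    (Equivalence.to ceiling⇔ bounded)))
  (λ χ2q< → Equivalence.from ceiling⇔ (subst₂ ℤ._<_ left right (ℤ.+<+ χ2q<)))
  where
  instance
    2q≢0 : NonZero (2 * q)
    2q≢0 = ℕ.m*n≢0 2 q

  ceiling⇔ = ≤ceiling-fraction⇔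
    ((ℤ.+ p ℚ./ (2 * q)) ℚ.* fromℕ (ω G)) (ℤ.+ p ℤ.* ℤ.+ ω G) (2 * q)
    (scaled-fraction (ℤ.+ p) (2 * q) (ω G)) (ℤ.+ χ G)

  left : ℤ.+ (χ G * (2 * q)) ≡ ℤ.+ χ G ℤ.* ℤ.+ (2 * q)
  left = ℤ.pos-* (χ G) (2 * q)

  right : ℤ.+ (p * ω G + 2 * q) ≡ ℤ.+ p ℤ.* ℤ.+ ω G ℤ.+ ℤ.+ (2 * q)
  right = cong (ℤ._+ ℤ.+ (2 * q)) (ℤ.pos-* p (ω G))

fromℕ-mono-≤ : m ℕ.≤ n → fromℕ m ≤ fromℕ n
fromℕ-mono-≤ {m} {n} m≤n = ℚ.toℚᵘ-cancel-≤ (begin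
  toℚᵘ (fromℕ m)       ≃⟨ ℚ.toℚᵘ-fromℚᵘ (mkℚᵘ (ℤ.+ m) 0) ⟩
  mkℚᵘ (ℤ.+ m) 0       ≤⟨ ℚᵘ.*≤* (ℤ.*-monoʳ-≤-nonNeg ℤ.1ℤ (ℤ.+≤+ m≤n)) ⟩
  mkℚᵘ (ℤ.+ n) 0       ≃⟨ ℚ.toℚᵘ-fromℚᵘ (mkℚᵘ (ℤ.+ n) 0) ⟨
  toℚᵘ (fromℕ n)       ∎)
  where open ℚᵘ.≤-Reasoning

-- Induction on the clique number.

module _ (p q : ℕ) .{{_ : NonZero q}} (F : Graph) (tf : TriangleFree F)
  (small : ∀ a → ω (cliqueBlowup F a) ℕ.≤ 2 * q → χ-Bounded p q (cliqueBlowup F a))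
  where

  private
    2q>0 : 2 * q ℕ.> 0
    2q>0 = ℕ.>-nonZero⁻¹ (2 * q) {{ℕ.m*n≢0 2 q}}

    bounded : ∀ a → Acc ℕ._<_ (ω (cliqueBlowup F a)) → χ-Bounded p q (cliqueBlowup F a)
    bounded a (acc rec) with ℕ.≤-<-connex (ω (cliqueBlowup F a)) (2 * q)
    ... | inj₁ ω≤2q = small a ω≤2q
    ... | inj₂ 2q<ω = Equivalence.from (χ-Bounded⇔ p q A) (begin-strict
      χ A * (2 * q)                       ≤⟨ ℕ.*-monoˡ-≤ (2 * q) χA≤χB+χC ⟩
      (χ B + χ C) * (2 * q)               ≤⟨ ℕ.*-monoˡ-≤ (2 * q) (ℕ.+-monoˡ-≤ (χ C) χB≤p) ⟩
      (p + χ C) * (2 * q)                 ≡⟨ ℕ.*-distribʳ-+ (2 * q) p (χ C) ⟩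
      p * (2 * q) + χ C * (2 * q)         <⟨ ℕ.+-monoʳ-< (p * (2 * q)) χC< ⟩
      p * (2 * q) + (p * ω C + 2 * q)     ≡⟨ regroup p (2 * q) (ω C) ⟩
      p * (2 * q + ω C) + 2 * q           ≤⟨ ℕ.+-monoˡ-≤ (2 * q) (ℕ.*-monoʳ-≤ p 2q+ωC≤ωA) ⟩
      p * ω A + 2 * q                     ∎)
      where
      open ℕ.≤-Reasoning
      A = cliqueBlowup F a
      B = cliqueBlowup F (removed F a q)
      C = cliqueBlowup F (remaining F a q)

      regroup : ∀ p d w → p * d + (p * w + d) ≡ p * (d + w) + d
      regroup = ℕ-Solver.solve-∀

      χA≤χB+χC : χ A ℕ.≤ χ B + χ C
      χA≤χB+χC = χ-subadditive F (a≤removed+remaining F a q)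

      2q+[ω∸2q] : 2 * q + (ω A ∸ 2 * q) ≡ ω A
      2q+[ω∸2q] = ℕ.m+[n∸m]≡n (ℕ.<⇒≤ 2q<ω)

      2q+ωC≤ωA : 2 * q + ω C ℕ.≤ ω A
      2q+ωC≤ωA = subst (2 * q + ω C ℕ.≤_) 2q+[ω∸2q]
        (ℕ.+-monoʳ-≤ (2 * q) (ω-least-edgeBound F _ tf (remaining-isEdgeBound F a q
          (subst (IsEdgeBound F a) (sym 2q+[ω∸2q]) (ω-isEdgeBound F a)))))

      ωB≤2q : ω B ℕ.≤ 2 * q
      ωB≤2q = ω-least-edgeBound F _ tf (removed-isEdgeBound F a q)

      χB≤p : χ B ℕ.≤ p
      -- At clique number `2 * q` the bound is exactly `p`: the strict inequality reads
      -- `χ B < p + 1` after cancelling `2 * q`.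
      χB≤p = ℕ.m<1+n⇒m≤n (ℕ.*-cancelʳ-< (2 * q) (χ B) (suc p) (begin-strict
        χ B * (2 * q)           <⟨ Equivalence.to (χ-Bounded⇔ p q B) (small _ ωB≤2q) ⟩
        p * ω B + 2 * q         ≤⟨ ℕ.+-monoˡ-≤ (2 * q) (ℕ.*-monoʳ-≤ p ωB≤2q) ⟩
        p * (2 * q) + 2 * q     ≡⟨ ℕ.+-comm (p * (2 * q)) (2 * q) ⟩
        suc p * (2 * q)         ∎))

      χC< : χ C * (2 * q) ℕ.< p * ω C + 2 * q
      χC< = Equivalence.to (χ-Bounded⇔ p q C) (bounded (remaining F a q)
        -- Since `2 * q` is positive, `ω C` is strictly below `ω A`.
        (rec (ℕ.<-≤-trans (ℕ.m<n+m (ω C) 2q>0) 2q+ωC≤ωA)))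

  bounded-upto-2q⇒bounded : ∀ a → χ-Bounded p q (cliqueBlowup F a)
  bounded-upto-2q⇒bounded a = bounded a (<-wellFounded _)

2q≤threshold : ∀ p q (p>2q : p > 2 * q) → fromℕ (2 * q) ≤ threshold p q p>2q
2q≤threshold p q p>2q = ℚ.p≤q⇒p≤r⊔q
  (((ℤ.+ (2 * q) ℤ.* (ℤ.+ p ℤ.- ℤ.+ q ℤ.- ℤ.+ 2)) ℚ./ (p ∸ 2 * q))
    {{ℕ.>-nonZero (ℕ.m<n⇒0<n∸m p>2q)}})
  ℚ.≤-refl

theorem1p1 : (p q : ℕ) .{{_ : NonZero p}} .{{_ : NonZero q}} (p>2q : p > 2 * q)
    (F : Graph) → TriangleFree F →
    ((a : Graph.Vertex F → ℕ) → χ-Bounded p q (cliqueBlowup F a))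
    ⇔ ((a : Graph.Vertex F → ℕ) →
    fromℕ (ω (cliqueBlowup F a)) ≤ threshold p q p>2q →
    χ-Bounded p q (cliqueBlowup F a))
theorem1p1 p q p>2q F tf = mk⇔
  (λ all a _ → all a)
  -- The base case of the induction concerns clique numbers up to `2 * q`, all of which lie within
  -- the threshold.
  λ below → bounded-upto-2q⇒bounded p q F tf λ a ω≤2q →
    below a (ℚ.≤-trans (fromℕ-mono-≤ ω≤2q) (2q≤threshold p q p>2q))
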